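{- (a) For $n\ge1$, the degree of $P_n$ is at most $n$. (b) For every $n$, $n!\,P_n(y)$ has integer coefficients.
   Context: Define polynomials $P_n(y)$ by $P_0(y)=y-1$ and, for $n\ge1$, $P_n=nP_{n-1}-P'_{n-1}+\frac{1}{n}\sum_{k=1}^{n-1}k\{(k-1)P_{k-1}-P_k-P'_{k-1}\}P_{n-k-1}$ (primes denote derivatives in $y$). Equivalently, $1+\sum_{n\ge1}P_{n-1}(y)x^{ -n}$ is the unique solution $V$, in the ring of formal series $\sum_{n\ge0}q_n(y)x^{ -n}$ with $\deg q_n\le n$, of $V=1+\frac{y}{x}-\frac{1}{x}V-V_x-\frac{1}{x}V_y+\frac{1}{x}\log V$, where $V_x,V_y$ are termwise formal derivatives and $\log$ is the formal logarithmic series. -}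

module Defs where

open import Data.Integer using (+_)
open import Data.List using (List; []; _∷_; map; foldr; applyUpTo)
open import Data.List.Properties using (map-cong-local)
open import Data.List.Relation.Unary.All using (All)
open import Data.List.Relation.Unary.All.Properties using (applyUpTo⁺₁)
open import Data.Maybe using (Maybe; just; nothing)
import Data.Maybe.Relation.Unary.All as Maybe
open import Data.Nat using (ℕ; zero; suc; _∸_; NonZero; _≤_; _<_; s≤s⁻¹)
open import Data.Nat.Properties using (_≤?_; ≤-refl; ≤-trans; m≤n⇒m<n∨m≡n; 1+n≰n; m∸n≤m; <⇒≤)
open import Data.Product using (∃-syntax)
open import Data.Rational using (ℚ; 0ℚ; 1ℚ; _+_; _*_; -_; _/_; _≟_)
open import Data.Sum using (inj₁; inj₂)
open import Relation.Binary.PropositionalEquality using (_≡_; refl; cong; cong₂)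
open import Relation.Nullary using (yes; no; contradiction)

infixl 6 _⊕_ _⊖_
infixl 7 _⊗_
infixr 8 _·_

-- a₀ ∷ a₁ ∷ … ∷ [] stands for a₀ + a₁ y + …; trailing zeros are allowed,
-- so a polynomial has several representations.
Poly : Set
Poly = List ℚ

_⊕_ : Poly → Poly → Poly
[]      ⊕ q       = q
(a ∷ p) ⊕ []      = a ∷ p
(a ∷ p) ⊕ (b ∷ q) = (a + b) ∷ (p ⊕ q)

_·_ : ℚ → Poly → Poly
c · p = map (c *_) p

_⊖_ : Poly → Poly → Poly
p ⊖ q = p ⊕ map -_ q

_⊗_ : Poly → Poly → Poly
[]      ⊗ q = []
(a ∷ p) ⊗ q = a · q ⊕ (0ℚ ∷ p ⊗ q)

-- (a + y p)′ = p + y p′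
deriv : Poly → Poly
deriv []      = []
deriv (a ∷ p) = p ⊕ (0ℚ ∷ deriv p)

-- `nothing` is the degree -∞ of the zero polynomial.
degree : Poly → Maybe ℕ
degree []      = nothing
degree (a ∷ p) with degree p | a ≟ 0ℚ
... | just d  | _     = just (suc d)
... | nothing | yes _ = nothing
... | nothing | no  _ = just 0

DegreeAtMost : ℕ → Poly → Set
DegreeAtMost n p = Maybe.All (_≤ n) (degree p)

IsInteger : ℚ → Set
IsInteger q = ∃[ z ] q ≡ z / 1

HasIntegerCoefficients : Poly → Set
HasIntegerCoefficients = All IsInteger

fromℕ : ℕ → ℚ
fromℕ n = + n / 1

∑[1≤k<_] : ℕ → (ℕ → Poly) → Poly
∑[1≤k< n ] f = foldr _⊕_ [] (map f (applyUpTo suc (n ∸ 1)))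

summand : (ℕ → Poly) → ℕ → ℕ → Poly
summand p n k =
  fromℕ k · ((fromℕ (k ∸ 1) · p (k ∸ 1) ⊖ p k ⊖ deriv (p (k ∸ 1))) ⊗ p (n ∸ k ∸ 1))

-- The right-hand side of the recurrence for the n-th polynomial; only p 0, …,
-- p (n ∸ 1) are used.
recurrence : (ℕ → Poly) → (n : ℕ) → .{{NonZero n}} → Poly
recurrence p n =
  fromℕ n · p (n ∸ 1) ⊖ deriv (p (n ∸ 1)) ⊕ (+ 1 / n) · ∑[1≤k< n ] (summand p n)

-- table n i is the i-th polynomial whenever i ≤ n (and a junk value otherwise).
table : ℕ → ℕ → Poly
table zero    i = - 1ℚ ∷ 1ℚ ∷ []
table (suc n) i with i ≤? n
... | yes _ = table n i
... | no  _ = recurrence (table n) (suc n)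

P : ℕ → Poly
P n = table n n

-- P-zero and P-rec together are the recursive definition of the polynomials.
P-zero : P 0 ≡ - 1ℚ ∷ 1ℚ ∷ []
P-zero = refl

table≡P : ∀ n i → i ≤ n → table n i ≡ P i
table≡P zero    zero i≤n = refl
table≡P (suc n) i i≤1+n with m≤n⇒m<n∨m≡n i≤1+n
... | inj₂ refl = refl
... | inj₁ i<1+n with i ≤? n
...   | yes i≤n = table≡P n i i≤n
...   | no  i≰n = contradiction (s≤s⁻¹ i<1+n) i≰n

recurrence-cong : ∀ {p q} n → (∀ i → i ≤ n → p i ≡ q i) →
                  recurrence p (suc n) ≡ recurrence q (suc n)
recurrence-cong {p} {q} n p≗q =
  cong₂ _⊕_
    (cong (λ r → fromℕ (suc n) · r ⊖ deriv r) (p≗q n ≤-refl))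
    (cong (λ rs → (+ 1 / suc n) · foldr _⊕_ [] rs)
      (map-cong-local (applyUpTo⁺₁ suc n summand-cong)))
  where
  summand-cong : ∀ {j} → j < n → summand p (suc n) (suc j) ≡ summand q (suc n) (suc j)
  summand-cong {j} j<n
    rewrite p≗q j (<⇒≤ j<n)
          | p≗q (suc j) j<n
          | p≗q (n ∸ j ∸ 1) (≤-trans (m∸n≤m (n ∸ j) 1) (m∸n≤m n j))
    = refl

P-rec : ∀ n → .{{_ : NonZero n}} → P n ≡ recurrence P n
P-rec (suc n) with suc n ≤? n
... | yes 1+n≤n = contradiction 1+n≤n 1+n≰n
... | no  _     = recurrence-cong n (table≡P n)

{-# OPTIONS --safe #-}

-- Both parts go by strong induction along the recurrence.  For (b), a common
-- denominator of the k-th summand is k! (n-1-k)!, which divides (n-1)! because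
-- binomial coefficients are integers, and the factor 1/n turns (n-1)! into n!.
-- For (a), P₀ has degree 1 rather than 0, so the inductive bound is
-- deg Pₙ ≤ max(1, n); it gives deg Pₙ₋ₖ₋₁ ≤ n - k, and the factor in braces has
-- degree at most k.
module Submission where

open import Defs
open import Algebra.Bundles using (CommutativeMonoid)
open import Data.Integer as ℤ using (+_)
import Data.Integer.Properties as ℤ
open import Data.List using ([]; _∷_; drop; map)
open import Data.List.Properties using (drop-map; foldr-preservesᵇ)
open import Data.List.Relation.Unary.All as All using (All; []; _∷_)
open import Data.List.Relation.Unary.All.Properties using (applyUpTo⁺₁; drop⁺; gmap⁺; map⁺)
open import Data.Maybe using (just; nothing)
import Data.Maybe.Relation.Unary.All as Maybe
open import Data.Nat as ℕ using (ℕ; zero; suc; _∸_; _⊔_; _≤_; _<_; z≤n; s≤s; _!)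
open import Data.Nat.Combinatorics using (k![n∸k]!∣n!)
open import Data.Nat.Coprimality as Coprime using (1-coprimeTo)
open import Data.Nat.Divisibility using (_∣_; divides; n∣m*n)
open import Data.Nat.Induction using (<-rec)
open import Data.Nat.Properties as ℕ using (≤-refl; ≤-trans; ≤-reflexive)
open import Data.Product using (_×_; _,_)
open import Data.Rational using (ℚ; mkℚ; 0ℚ; 1ℚ; _+_; _*_; -_; _/_; _≟_; toℚᵘ)
open import Data.Rational.Properties using (*-1-commutativeMonoid; *-assoc; *-distribˡ-+; *-zeroʳ; *-zeroˡ; neg-distribʳ-*; toℚᵘ-fromℚᵘ; toℚᵘ-homo-*; toℚᵘ-injective; ↥p/↧p≡p)
open import Algebra.Properties.CommutativeSemigroup (CommutativeMonoid.commutativeSemigroup *-1-commutativeMonoid) using (interchange; x∙yz≈y∙xz)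
open import Data.Rational.Unnormalised as ℚᵘ using (mkℚᵘ; *≡*)
import Data.Rational.Unnormalised.Properties as ℚᵘ
open import Relation.Binary.PropositionalEquality using (_≡_; refl; sym; trans; cong; cong₂; subst; module ≡-Reasoning)
import Relation.Binary.Reasoning.Setoid as SetoidReasoning
open import Relation.Nullary using (yes; no; contradiction)

-- Properties of coefficients under the polynomial operations.

module _ {Q : ℚ → Set} (+-closed : ∀ {a b} → Q a → Q b → Q (a + b)) where

  All-⊕ : ∀ {p q} → All Q p → All Q q → All Q (p ⊕ q)
  All-⊕ []        qs        = qs
  All-⊕ (pa ∷ ps) []        = pa ∷ ps
  All-⊕ (pa ∷ ps) (qb ∷ qs) = +-closed pa qb ∷ All-⊕ ps qs

  All-deriv : Q 0ℚ → ∀ {p} → All Q p → All Q (deriv p)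
  All-deriv q0 []        = []
  All-deriv q0 (_ ∷ ps)  = All-⊕ ps (q0 ∷ All-deriv q0 ps)

-- Each coefficient of a product is a sum of products of coefficients. There are three predicates
-- because the two factors and their product are cleared by different denominators.
All-⊗ : ∀ {A B C : ℚ → Set} → (∀ {a b} → C a → C b → C (a + b)) → C 0ℚ →
        (∀ {a b} → A a → B b → C (a * b)) →
        ∀ {p q} → All A p → All B q → All C (p ⊗ q)
All-⊗ +-closed c0 *-closed []        qs = []
All-⊗ +-closed c0 *-closed (pa ∷ ps) qs =
  All-⊕ +-closed (gmap⁺ (*-closed pa) qs) (c0 ∷ All-⊗ +-closed c0 *-closed ps qs)

∑-preserves : ∀ {Q : Poly → Set} → (∀ {p q} → Q p → Q q → Q (p ⊕ q)) → Q [] →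
              ∀ n {f} → (∀ {j} → j < n → Q (f (suc j))) → Q (∑[1≤k< suc n ] f)
∑-preserves {Q} ⊕-closed q[] n qf =
  foldr-preservesᵇ {P = Q} ⊕-closed q[] (map⁺ {P = Q} (applyUpTo⁺₁ suc n qf))

-- In `summand` at n + 1 with k = j + 1, the index of the second factor computes to `n ∸ j ∸ 1`; in
-- terms of k this is n - k.
n∸j∸1≡n∸1+j : ∀ n j → n ∸ j ∸ 1 ≡ n ∸ suc j
n∸j∸1≡n∸1+j n j = trans (ℕ.∸-+-assoc n j 1) (cong (n ∸_) (ℕ.+-comm j 1))

n∸j∸1<1+n : ∀ n j → n ∸ j ∸ 1 < suc n
n∸j∸1<1+n n j = s≤s (≤-trans (ℕ.m∸n≤m (n ∸ j) 1) (ℕ.m∸n≤m n j))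

-- Degree bounds.

infix 4 _degree≤_

-- Vanishing beyond position n ignores trailing zeros and, unlike `degree`, involves no decision
-- whether a coefficient is zero, so it follows the list recursions directly.
_degree≤_ : Poly → ℕ → Set
p degree≤ n = All (_≡ 0ℚ) (drop (suc n) p)

0+0-closed : ∀ {a b} → a ≡ 0ℚ → b ≡ 0ℚ → a + b ≡ 0ℚ
0+0-closed refl refl = refl

drop-⊕ : ∀ n p q → drop n (p ⊕ q) ≡ drop n p ⊕ drop n q
drop-⊕ zero    p       q       = refl
drop-⊕ (suc n) []      q       = refl
-- `_⊕_` splits on its first argument, so `drop n p ⊕ []` reduces only once the shape of `drop n p`
-- is known.
drop-⊕ (suc n) (a ∷ p) []      with drop n p
... | []    = refl
... | _ ∷ _ = refl
drop-⊕ (suc n) (a ∷ p) (b ∷ q) = drop-⊕ n p q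

vanish-⊕ : ∀ n {p q} → All (_≡ 0ℚ) (drop n p) → All (_≡ 0ℚ) (drop n q) →
           All (_≡ 0ℚ) (drop n (p ⊕ q))
vanish-⊕ n {p} {q} zp zq = subst (All _) (sym (drop-⊕ n p q)) (All-⊕ 0+0-closed zp zq)

degree≤-mono : ∀ {m n} p → m ≤ n → p degree≤ m → p degree≤ n
degree≤-mono         []      m≤n       dp = []
degree≤-mono {n = n} (a ∷ p) z≤n       dp = drop⁺ n dp
degree≤-mono         (a ∷ p) (s≤s m≤n) dp = degree≤-mono p m≤n dp

degree≤-map : ∀ {f} → f 0ℚ ≡ 0ℚ → ∀ n p → p degree≤ n → map f p degree≤ n
degree≤-map {f} f0 n p dp =
  subst (All _) (sym (drop-map (suc n) p)) (gmap⁺ (λ a≡0 → trans (cong f a≡0) f0) dp)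

degree≤-⊕ : ∀ n p q → p degree≤ n → q degree≤ n → p ⊕ q degree≤ n
degree≤-⊕ n p q = vanish-⊕ (suc n) {p} {q}

degree≤-· : ∀ c n p → p degree≤ n → c · p degree≤ n
degree≤-· c = degree≤-map (*-zeroʳ c)

degree≤-⊖ : ∀ n p q → p degree≤ n → q degree≤ n → p ⊖ q degree≤ n
degree≤-⊖ n p q dp dq = degree≤-⊕ n p _ dp (degree≤-map refl n q dq)

-- Induction on (a + y p)′ = p + y p′. Not lowering the bound costs nothing later, as each
-- derivative in the recurrence stands beside a multiple of the same polynomial.
degree≤-deriv : ∀ n p → p degree≤ n → deriv p degree≤ n
degree≤-deriv n       []      dp = []
degree≤-deriv zero    (a ∷ p) dp =
  drop⁺ 1 (All-⊕ 0+0-closed {p} dp (refl ∷ All-deriv 0+0-closed refl dp))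
degree≤-deriv (suc n) (a ∷ p) dp =
  vanish-⊕ (suc (suc n)) {p} {0ℚ ∷ deriv p} (degree≤-mono p (ℕ.n≤1+n n) dp) (degree≤-deriv n p dp)

-- Induction on m through (a + y p) q = a q + y (p q); the shift by y raises m to m + 1.
degree≤-⊗ : ∀ m n p q → p degree≤ m → q degree≤ n → p ⊗ q degree≤ m ℕ.+ n
degree≤-⊗ m n [] q dp dq = []
degree≤-⊗ zero n (a ∷ p) q dp dq =
  degree≤-⊕ n (a · q) (0ℚ ∷ p ⊗ q) (degree≤-· a n q dq)
    -- For m = 0 all coefficients of the tail p are zero, hence also those of `p ⊗ q`; `b ≡ b` is a
    -- trivial condition on q.
    (drop⁺ n (All-⊗ {B = λ b → b ≡ b} 0+0-closed refl (λ { {b = b} refl _ → *-zeroˡ b }) dp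
      (All.universal (λ _ → refl) q)))
degree≤-⊗ (suc m) n (a ∷ p) q dp dq =
  degree≤-⊕ (suc m ℕ.+ n) (a · q) (0ℚ ∷ p ⊗ q)
    (degree≤-mono (a · q) (ℕ.m≤n+m n (suc m)) (degree≤-· a n q dq))
    (degree≤-⊗ m n p q dp dq)

degree-zero : ∀ {p} → All (_≡ 0ℚ) p → degree p ≡ nothing
degree-zero [] = refl
degree-zero {a ∷ p} (a≡0 ∷ zp) rewrite degree-zero zp with a ≟ 0ℚ
... | yes _   = refl
... | no  a≢0 = contradiction a≡0 a≢0

-- In the base case the vanishing tail has degree `nothing`, so only the constant coefficient can
-- count.
degree≤⇒DegreeAtMost : ∀ n p → p degree≤ n → DegreeAtMost n p
degree≤⇒DegreeAtMost n       []      dp = Maybe.nothing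
degree≤⇒DegreeAtMost zero    (a ∷ p) dp rewrite degree-zero dp with a ≟ 0ℚ
... | yes _ = Maybe.nothing
... | no  _ = Maybe.just z≤n
degree≤⇒DegreeAtMost (suc n) (a ∷ p) dp
  with degree p | degree≤⇒DegreeAtMost n p dp | a ≟ 0ℚ
... | just d  | Maybe.just d≤n | _     = Maybe.just (s≤s d≤n)
... | nothing | _              | yes _ = Maybe.nothing
... | nothing | _              | no  _ = Maybe.just z≤n

-- Degrees along the recurrence.

1⊔n≤1+n : ∀ n → 1 ⊔ n ≤ suc n
1⊔n≤1+n n = ℕ.⊔-lub (s≤s z≤n) (ℕ.n≤1+n n)

P-degree≤ : ∀ n → P n degree≤ 1 ⊔ n
P-degree≤ = <-rec _ step
  where
  step : ∀ n → (∀ {i} → i < n → P i degree≤ 1 ⊔ i) → P n degree≤ 1 ⊔ n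
  step zero    ih = []
  step (suc m) ih = subst (_degree≤ suc m) (sym (P-rec (suc m)))
    (degree≤-⊕ (suc m) (fromℕ (suc m) · P m ⊖ deriv (P m)) _
      (degree≤-⊖ (suc m) (fromℕ (suc m) · P m) _
        (degree≤-· (fromℕ (suc m)) (suc m) (P m) (weak ≤-refl))
        (degree≤-deriv (suc m) (P m) (weak ≤-refl)))
      (degree≤-· (+ 1 / suc m) (suc m) (∑[1≤k< suc m ] (summand P (suc m)))
        (∑-preserves {_degree≤ suc m} (λ {p} {q} → degree≤-⊕ (suc m) p q) []
          m {summand P (suc m)} summand-degree≤)))
    where
    -- The slack bound i + 1 covers P₀ as well and suffices for every term except Pₖ in the braces.
    weak : ∀ {i} → i < suc m → P i degree≤ suc i
    weak {i} i<1+m = degree≤-mono (P i) (1⊔n≤1+n i) (ih i<1+m)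

    summand-degree≤ : ∀ {j} → j < m → summand P (suc m) (suc j) degree≤ suc m
    summand-degree≤ {j} j<m =
      degree≤-· (fromℕ (suc j)) (suc m) (brace ⊗ P (m ∸ j ∸ 1))
        (degree≤-mono (brace ⊗ P (m ∸ j ∸ 1)) (≤-reflexive total)
          (degree≤-⊗ (suc j) (suc (m ∸ j ∸ 1)) brace (P (m ∸ j ∸ 1))
            brace-degree≤ (weak (n∸j∸1<1+n m j))))
      where
      brace : Poly
      brace = fromℕ j · P j ⊖ P (suc j) ⊖ deriv (P j)

      Pj-degree≤ : P j degree≤ suc j
      Pj-degree≤ = weak (ℕ.m<n⇒m<1+n j<m)

      brace-degree≤ : brace degree≤ suc j
      brace-degree≤ =
        degree≤-⊖ (suc j) (fromℕ j · P j ⊖ P (suc j)) _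
          (degree≤-⊖ (suc j) (fromℕ j · P j) (P (suc j))
            (degree≤-· (fromℕ j) (suc j) (P j) Pj-degree≤)
            -- The slack bound k + 1 would be too large here; `1 ⊔ suc j` reduces to `suc j`, which
            -- is k.
            (ih (s≤s j<m)))
          (degree≤-deriv (suc j) (P j) Pj-degree≤)

      -- This is k + (n - k) = n for n = m + 1; j < m makes the truncated subtraction exact.
      total : suc j ℕ.+ suc (m ∸ j ∸ 1) ≡ suc m
      total = begin
        suc j ℕ.+ suc (m ∸ j ∸ 1)  ≡⟨ ℕ.+-suc (suc j) (m ∸ j ∸ 1) ⟩
        suc (suc j ℕ.+ (m ∸ j ∸ 1)) ≡⟨ cong (λ i → suc (suc j ℕ.+ i)) (n∸j∸1≡n∸1+j m j) ⟩
        suc (suc j ℕ.+ (m ∸ suc j)) ≡⟨ cong suc (ℕ.m+[n∸m]≡n j<m) ⟩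
        suc m ∎
        where open ≡-Reasoning

-- Integers among the rationals, and common denominators.

-- `_/_` normalises through a gcd and is stuck on a variable numerator; on operands in constructor
-- form `_+_` and `_*_` unfold.
i/1≡mkℚ : ∀ i → i / 1 ≡ mkℚ i 0 (Coprime.sym (1-coprimeTo _))
i/1≡mkℚ i = ↥p/↧p≡p (mkℚ i 0 _)

/1-homo-+ : ∀ i j → i / 1 + j / 1 ≡ (i ℤ.+ j) / 1
/1-homo-+ i j = trans (cong₂ _+_ (i/1≡mkℚ i) (i/1≡mkℚ j))
  (cong (_/ 1) (cong₂ ℤ._+_ (ℤ.*-identityʳ i) (ℤ.*-identityʳ j)))

/1-homo-* : ∀ i j → (i / 1) * (j / 1) ≡ (i ℤ.* j) / 1
/1-homo-* i j = cong₂ _*_ (i/1≡mkℚ i) (i/1≡mkℚ j)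

/1-homo-neg : ∀ i → - (i / 1) ≡ (ℤ.- i) / 1
/1-homo-neg (+ zero)   = refl
/1-homo-neg (+ suc n)  = refl
/1-homo-neg ℤ.-[1+ n ] = trans (cong -_ (i/1≡mkℚ ℤ.-[1+ n ])) (sym (i/1≡mkℚ (+ suc n)))

isInteger-+ : ∀ {a b} → IsInteger a → IsInteger b → IsInteger (a + b)
isInteger-+ (i , refl) (j , refl) = i ℤ.+ j , /1-homo-+ i j

isInteger-* : ∀ {a b} → IsInteger a → IsInteger b → IsInteger (a * b)
isInteger-* (i , refl) (j , refl) = i ℤ.* j , /1-homo-* i j

isInteger-neg : ∀ {a} → IsInteger a → IsInteger (- a)
isInteger-neg (i , refl) = ℤ.- i , /1-homo-neg i

fromℕ-* : ∀ m n → fromℕ (m ℕ.* n) ≡ fromℕ m * fromℕ n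
fromℕ-* m n = trans (cong (_/ 1) (ℤ.pos-* m n)) (sym (/1-homo-* (+ m) (+ n)))

fromℕ-isInteger : ∀ n → IsInteger (fromℕ n)
fromℕ-isInteger n = + n , refl

-- Among unnormalised rationals there is no gcd to compute: equality is cross-multiplication, an
-- identity of integers.
fromℕ-inverseʳ : ∀ n → fromℕ (suc n) * (+ 1 / suc n) ≡ 1ℚ
fromℕ-inverseʳ n = toℚᵘ-injective (begin
  toℚᵘ (fromℕ (suc n) * (+ 1 / suc n))
    ≈⟨ toℚᵘ-homo-* (fromℕ (suc n)) (+ 1 / suc n) ⟩
  toℚᵘ (fromℕ (suc n)) ℚᵘ.* toℚᵘ (+ 1 / suc n)
    ≈⟨ ℚᵘ.*-cong (toℚᵘ-fromℚᵘ (mkℚᵘ (+ suc n) 0)) (toℚᵘ-fromℚᵘ (mkℚᵘ (+ 1) n)) ⟩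
  mkℚᵘ (+ suc n) 0 ℚᵘ.* mkℚᵘ (+ 1) n
    ≈⟨ *≡* (trans (ℤ.*-comm (+ suc n ℤ.* + 1) (+ 1)) (cong (+ 1 ℤ.*_) (ℤ.*-comm (+ suc n) (+ 1)))) ⟩
  toℚᵘ 1ℚ ∎)
  where open SetoidReasoning ℚᵘ.≃-setoid

-- A record, so that d and a can be inferred: _*_ on ℚ unfolds and is not injective.
record DenominatorDivides (d : ℕ) (a : ℚ) : Set where
  constructor clears
  field cleared : IsInteger (fromℕ d * a)

open DenominatorDivides

module _ {d : ℕ} where

  denominator-0 : DenominatorDivides d 0ℚ
  denominator-0 = clears (+ 0 , *-zeroʳ (fromℕ d))

  denominator-+ : ∀ {a b} → DenominatorDivides d a → DenominatorDivides d b →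
                  DenominatorDivides d (a + b)
  denominator-+ {a} {b} (clears da) (clears db) = clears
    (subst IsInteger (sym (*-distribˡ-+ (fromℕ d) a b)) (isInteger-+ da db))

  denominator-neg : ∀ {a} → DenominatorDivides d a → DenominatorDivides d (- a)
  denominator-neg {a} (clears da) = clears
    (subst IsInteger (neg-distribʳ-* (fromℕ d) a) (isInteger-neg da))

  denominator-scale : ∀ n {a} → DenominatorDivides d a → DenominatorDivides d (fromℕ n * a)
  denominator-scale n {a} (clears da) = clears
    (subst IsInteger (x∙yz≈y∙xz (fromℕ n) (fromℕ d) a) (isInteger-* (fromℕ-isInteger n) da))

  denominator-* : ∀ {e a b} → DenominatorDivides d a → DenominatorDivides e b →
                  DenominatorDivides (d ℕ.* e) (a * b)
  denominator-* {e} {a} {b} (clears da) (clears eb) = clears (subst IsInteger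
    (trans (interchange (fromℕ d) a (fromℕ e) b) (cong (_* (a * b)) (sym (fromℕ-* d e))))
    (isInteger-* da eb))

  denominator-∣ : ∀ {e a} → d ∣ e → DenominatorDivides d a → DenominatorDivides e a
  denominator-∣ {a = a} (divides q refl) (clears da) = clears (subst IsInteger
    (trans (sym (*-assoc (fromℕ q) (fromℕ d) a)) (cong (_* a) (sym (fromℕ-* q d))))
    (isInteger-* (fromℕ-isInteger q) da))

  denominator-⊖ : ∀ {p q} → All (DenominatorDivides d) p → All (DenominatorDivides d) q →
                  All (DenominatorDivides d) (p ⊖ q)
  denominator-⊖ dp dq = All-⊕ denominator-+ dp (gmap⁺ denominator-neg dq)

denominator-1/ : ∀ n → DenominatorDivides (suc n) (+ 1 / suc n)
denominator-1/ n = clears (+ 1 , fromℕ-inverseʳ n)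

-- Denominators along the recurrence.

P-denominator : ∀ n → All (DenominatorDivides (n !)) (P n)
P-denominator = <-rec _ step
  where
  step : ∀ n → (∀ {i} → i < n → All (DenominatorDivides (i !)) (P i)) →
         All (DenominatorDivides (n !)) (P n)
  step zero    ih = clears (ℤ.- + 1 , refl) ∷ clears (+ 1 , refl) ∷ []
  step (suc m) ih = subst (All (DenominatorDivides (suc m !))) (sym (P-rec (suc m)))
    (All-⊕ denominator-+
      (denominator-⊖ (gmap⁺ (denominator-scale (suc m)) Pm)
        (All-deriv denominator-+ denominator-0 Pm))
      -- `suc m !` unfolds to `suc m ℕ.* m !`, the denominator of 1/n times that of the sum.
      (gmap⁺ (denominator-* (denominator-1/ m))
        (∑-preserves {All (DenominatorDivides (m !))} (All-⊕ denominator-+) []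
          m summand-denominator)))
    where
    -- Takes Pₖ₋₁ and its derivative from (k-1)! to the k! of Pₖ, giving the braces one common
    -- denominator; likewise Pₙ₋₁ goes to n!.
    raise : ∀ j {p} → All (DenominatorDivides (j !)) p → All (DenominatorDivides (suc j !)) p
    raise j = All.map (denominator-∣ (n∣m*n (suc j)))

    Pm : All (DenominatorDivides (suc m !)) (P m)
    Pm = raise m (ih ≤-refl)

    summand-denominator : ∀ {j} → j < m →
                          All (DenominatorDivides (m !)) (summand P (suc m) (suc j))
    summand-denominator {j} j<m =
      gmap⁺ (denominator-scale (suc j))
        (All.map (denominator-∣ factorials)
          (All-⊗ denominator-+ denominator-0 denominator-*
            (denominator-⊖ (denominator-⊖ (gmap⁺ (denominator-scale j) Pj) (ih (s≤s j<m)))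
              (All-deriv denominator-+ denominator-0 Pj))
            (ih (n∸j∸1<1+n m j))))
      where
      Pj : All (DenominatorDivides (suc j !)) (P j)
      Pj = raise j (ih (ℕ.m<n⇒m<1+n j<m))

      factorials : suc j ! ℕ.* (m ∸ j ∸ 1) ! ∣ m !
      factorials rewrite n∸j∸1≡n∸1+j m j = k![n∸k]!∣n! j<m

theorem4p5 : (∀ n → 1 ≤ n → DegreeAtMost n (P n)) × (∀ n → HasIntegerCoefficients (fromℕ (n !) · P n))
-- The coefficients of n! Pₙ are literally the products in the field `cleared`.
theorem4p5 = degree-bound , λ n → gmap⁺ cleared (P-denominator n)
  where
  degree-bound : ∀ n → 1 ≤ n → DegreeAtMost n (P n)
  degree-bound (suc n) _ = degree≤⇒DegreeAtMost (suc n) (P (suc n)) (P-degree≤ (suc n))
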